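{- Let $\Gamma$ be a tetravalent graph admitting a subgroup $G\le\mathrm{Aut}(\Gamma)$ acting regularly on the arcs of $\Gamma$. If $\Gamma$ is the underlying graph of a map $\mathcal M$ in class $2_{\{0,1\}}$ with $\mathrm{Aut}(\mathcal M)=G$, then all orbits of $G$-consistent cycles of $\Gamma$ are $G$-symmetric. Moreover, if $G=\mathrm{Aut}(\Gamma)$ and all orbits of $G$-consistent cycles of $\Gamma$ are $G$-symmetric, then for any two orbits of $G$-consistent cycles of $\Gamma$ there exists a map $\mathcal M$ in class $2_{\{0,1\}}$ with $\mathrm{Aut}(\mathcal M)=G$ and underlying graph $\Gamma$ whose face boundaries are exactly the members of these two orbits.
   Context: A map is a $2$-cell embedding of a connected simple graph (its underlying graph) in a closed surface; the components of the complement are the faces. All maps considered are polytopal: flags correspond bijectively to incident triples (vertex, edge, face). For a flag $\Phi$ and $i\in\{0,1,2\}$, $\Phi^i$ is the unique flag differing from $\Phi$ exactly in its vertex ($i=0$), edge ($i=1$) or face ($i=2$). $\mathrm{Aut}(\mathcal M)$ is the group of automorphisms of the underlying graph preserving the set of faces, acting on flags. A map is in class $2_{\{0,1\}}$ if $\mathrm{Aut}(\mathcal M)$ has exactly two orbits on flags and for every flag $\Phi$, the flags $\Phi^0,\Phi^1$ lie in the orbit of $\Phi$ while $\Phi^2$ does not. For an arc-transitive $G\le\mathrm{Aut}(\Gamma)$, a directed cycle $(v_0,\ldots,v_{r-1})$ is $G$-consistent if some $g\in G$ maps each $v_i$ to $v_{i+1}$ (indices mod $r$); an undirected cycle is $G$-consistent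 if both orientations are; it is $G$-symmetric if moreover some element of $G$ maps one orientation to the other. $G$ acts on the set of $G$-consistent cycles, giving orbits of $G$-consistent cycles. -}

module Defs where

open import Algebra.Bundles using (Group)
open import Data.Empty using (⊥-elim)
open import Data.Fin.Base using (Fin; toℕ; opposite)
open import Data.Fin.Patterns using (0F; 1F; 2F)
open import Data.Fin.Permutation as Perm using (Permutation′; _⟨$⟩ʳ_; _∘ₚ_)
open import Data.Fin.Properties
  using (toℕ-injective; toℕ-fromℕ<; toℕ<n; toℕ≤pred[n]; opposite-prop; opposite-involutive)
open import Data.List.Base using (length; filter; allFin)
open import Data.Nat.Base using (ℕ; suc; _+_; _∸_; _≤_; _<_; z≤n; s≤s)
open import Data.Nat.DivMod
  using (_mod_; _%_; m%n<n; m<n⇒m%n≡m; n%n≡0; [m+n]%n≡m%n; %-distribˡ-+; m%n%n≡m%n)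
import Data.Nat.Properties as ℕₚ
open import Data.Product.Base using (Σ; ∃₂; ∃-syntax; _×_; _,_; proj₁; proj₂)
open import Data.Product using (∃!)
open import Data.Sum.Base as Sum using (_⊎_; inj₁; inj₂; swap)
open import Function.Base using (_∘_)
open import Function.Bundles using (_⇔_; mk⇔; Equivalence)
open import Function.Definitions using (Injective)
open import Level using (Level; 0ℓ; _⊔_) renaming (suc to lsuc)
open import Relation.Binary.Construct.Closure.ReflexiveTransitive using (Star)
open import Relation.Binary.Core using (Rel)
open import Relation.Binary.Definitions using (Symmetric; Irreflexive; Decidable; _Respects_)
open import Relation.Binary.PropositionalEquality
  using (_≡_; _≢_; refl; sym; trans; cong; subst; module ≡-Reasoning)
open import Relation.Nullary using (¬_; yes; no)
open import Relation.Unary using (Pred; _∈_; _⊆_)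

open Equivalence using (to; from)

private
  variable
    c ℓ : Level
    n r : ℕ

record Graph (n : ℕ) : Set₁ where
  field
    Adj    : Rel (Fin n) 0ℓ
    adj?   : Decidable Adj
    adjSym : Symmetric Adj
    adjIrr : Irreflexive _≡_ Adj

  degree : Fin n → ℕ
  degree v = length (filter (adj? v) (allFin n))

  Connected : Set
  Connected = Fin n × (∀ u v → Star Adj u v)

  Tetravalent : Set
  Tetravalent = ∀ v → degree v ≡ 4

record Subgroup (𝔾 : Group c ℓ) : Set (c ⊔ ℓ ⊔ lsuc 0ℓ) where
  open Group 𝔾
  field
    carrier : Pred Carrier 0ℓ
    resp    : carrier Respects _≈_
    ε∈      : ε ∈ carrier
    ∙∈      : ∀ {g h} → g ∈ carrier → h ∈ carrier → g ∙ h ∈ carrier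
    ⁻¹∈     : ∀ {g} → g ∈ carrier → g ⁻¹ ∈ carrier

open Subgroup public using (carrier)

module _ (Γ : Graph n) where
  open Graph Γ

  record Automorphism : Set where
    constructor aut
    field
      perm      : Permutation′ n
      preserves : ∀ {u v} → Adj u v ⇔ Adj (perm ⟨$⟩ʳ u) (perm ⟨$⟩ʳ v)

module _ {Γ : Graph n} where
  open Graph Γ

  infixr 20 _·_

  _·_ : Automorphism Γ → Fin n → Fin n
  g · v = Automorphism.perm g ⟨$⟩ʳ v

  infix 4 _≈ᵃ_

  _≈ᵃ_ : Rel (Automorphism Γ) 0ℓ
  g ≈ᵃ h = ∀ v → g · v ≡ h · v

module _ (Γ : Graph n) where
  open Graph Γ

  private
    _∘ᵃ_ : Automorphism Γ → Automorphism Γ → Automorphism Γ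
    aut p p-adj ∘ᵃ aut q q-adj = aut (q ∘ₚ p)
      (mk⇔ (to p-adj ∘ to q-adj) (from q-adj ∘ from p-adj))

    _⁻¹ᵃ : Automorphism Γ → Automorphism Γ
    aut p p-adj ⁻¹ᵃ = aut (Perm.flip p) (mk⇔
      (λ a → from p-adj (subst₂′ (sym (Perm.inverseʳ p)) (sym (Perm.inverseʳ p)) a))
      (λ a → subst₂′ (Perm.inverseʳ p) (Perm.inverseʳ p) (to p-adj a)))
      where
      subst₂′ : ∀ {a b a′ b′} → a ≡ a′ → b ≡ b′ → Adj a b → Adj a′ b′
      subst₂′ refl refl x = x

  -- The product g ∙ h applies h first.
  Aut : Group 0ℓ 0ℓ
  Aut = record
    { Carrier = Automorphism Γ
    ; _≈_     = _≈ᵃ_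
    ; _∙_     = _∘ᵃ_
    ; ε       = aut Perm.id (mk⇔ (λ a → a) (λ a → a))
    ; _⁻¹     = _⁻¹ᵃ
    ; isGroup = record
      { isMonoid = record
        { isSemigroup = record
          { isMagma = record
            { isEquivalence = record
              { refl  = λ _ → refl
              ; sym   = λ p v → sym (p v)
              ; trans = λ p q v → trans (p v) (q v)
              }
            ; ∙-cong = λ {g} {_} {_} {k} p q v → trans (cong (g ·_) (q v)) (p (k · v))
            }
          ; assoc = λ _ _ _ _ → refl
          }
        ; identity = (λ _ _ → refl) , (λ _ _ → refl)
        }
      ; inverse = (λ g _ → Perm.inverseˡ (Automorphism.perm g))
                , (λ g _ → Perm.inverseʳ (Automorphism.perm g))
      ; ⁻¹-cong = λ {g} {h} p v → let π = Automorphism.perm g ; ρ = Automorphism.perm h in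
          begin
            π Perm.⟨$⟩ˡ v                                  ≡⟨ cong (π Perm.⟨$⟩ˡ_) (sym (Perm.inverseʳ ρ)) ⟩
            π Perm.⟨$⟩ˡ (ρ ⟨$⟩ʳ (ρ Perm.⟨$⟩ˡ v))           ≡⟨ cong (π Perm.⟨$⟩ˡ_) (sym (p (ρ Perm.⟨$⟩ˡ v))) ⟩
            π Perm.⟨$⟩ˡ (π ⟨$⟩ʳ (ρ Perm.⟨$⟩ˡ v))           ≡⟨ Perm.inverseˡ π ⟩
            ρ Perm.⟨$⟩ˡ v                                  ∎
      }
    }
    where open ≡-Reasoning

module _ {Γ : Graph n} where
  open Graph Γ

  ArcRegular : Subgroup (Aut Γ) → Set
  ArcRegular G = ∀ {u v u′ v′} → Adj u v → Adj u′ v′ →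
    ∃! _≈ᵃ_ λ g → g ∈ carrier G × g · u ≡ u′ × g · v ≡ v′

next : Fin r → Fin r
next {suc r} i = suc (toℕ i) mod suc r

prev : Fin r → Fin r
prev {suc r} i = (r + toℕ i) mod suc r

private
  toℕ-mod : ∀ m r → toℕ (m mod suc r) ≡ m % suc r
  toℕ-mod m r = toℕ-fromℕ< (m%n<n m (suc r))

  +-%ʳ : ∀ a b r → (a + b % suc r) % suc r ≡ (a + b) % suc r
  +-%ʳ a b r = begin
    (a + b % suc r) % suc r                          ≡⟨ %-distribˡ-+ a (b % suc r) (suc r) ⟩
    (a % suc r + b % suc r % suc r) % suc r          ≡⟨ cong (λ x → (a % suc r + x) % suc r) (m%n%n≡m%n b (suc r)) ⟩
    (a % suc r + b % suc r) % suc r                  ≡⟨ sym (%-distribˡ-+ a b (suc r)) ⟩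
    (a + b) % suc r                                  ∎
    where open ≡-Reasoning

  wrap : (i : Fin (suc r)) → (suc r + toℕ i) % suc r ≡ toℕ i
  wrap {r} i = begin
    (suc r + toℕ i) % suc r  ≡⟨ cong (_% suc r) (ℕₚ.+-comm (suc r) (toℕ i)) ⟩
    (toℕ i + suc r) % suc r  ≡⟨ [m+n]%n≡m%n (toℕ i) (suc r) ⟩
    toℕ i % suc r            ≡⟨ m<n⇒m%n≡m (toℕ<n i) ⟩
    toℕ i                    ∎
    where open ≡-Reasoning

next-prev : (i : Fin r) → next (prev i) ≡ i
next-prev {suc r} i = toℕ-injective (begin
  toℕ (next (prev i))                    ≡⟨ toℕ-mod (suc (toℕ (prev i))) r ⟩
  suc (toℕ (prev i)) % suc r             ≡⟨ cong (λ x → suc x % suc r) (toℕ-mod (r + toℕ i) r) ⟩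
  (1 + (r + toℕ i) % suc r) % suc r      ≡⟨ +-%ʳ 1 (r + toℕ i) r ⟩
  (suc r + toℕ i) % suc r                ≡⟨ wrap i ⟩
  toℕ i                                  ∎)
  where open ≡-Reasoning

prev-next : (i : Fin r) → prev (next i) ≡ i
prev-next {suc r} i = toℕ-injective (begin
  toℕ (prev (next i))                    ≡⟨ toℕ-mod (r + toℕ (next i)) r ⟩
  (r + toℕ (next i)) % suc r             ≡⟨ cong (λ x → (r + x) % suc r) (toℕ-mod (suc (toℕ i)) r) ⟩
  (r + suc (toℕ i) % suc r) % suc r      ≡⟨ +-%ʳ r (suc (toℕ i)) r ⟩
  (r + suc (toℕ i)) % suc r              ≡⟨ cong (_% suc r) (ℕₚ.+-suc r (toℕ i)) ⟩
  (suc r + toℕ i) % suc r                ≡⟨ wrap i ⟩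
  toℕ i                                  ∎)
  where open ≡-Reasoning

next-last : (i : Fin (suc r)) → toℕ i ≡ r → toℕ (next i) ≡ 0
next-last {r} i i≡r = begin
  toℕ (next i)          ≡⟨ toℕ-mod (suc (toℕ i)) r ⟩
  suc (toℕ i) % suc r   ≡⟨ cong (λ x → suc x % suc r) i≡r ⟩
  suc r % suc r         ≡⟨ n%n≡0 (suc r) ⟩
  0                     ∎
  where open ≡-Reasoning

next-inner : (i : Fin (suc r)) → toℕ i < r → toℕ (next i) ≡ suc (toℕ i)
next-inner {r} i i<r = trans (toℕ-mod (suc (toℕ i)) r) (m<n⇒m%n≡m (s≤s i<r))

next-opposite-next : (i : Fin r) → next (opposite (next i)) ≡ opposite i
next-opposite-next {suc r} i = toℕ-injective (helper (toℕ i ℕₚ.≟ r))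
  where
  open ≡-Reasoning
  helper : _ → toℕ (next (opposite (next i))) ≡ toℕ (opposite i)
  helper (yes i≡r) = begin
    toℕ (next (opposite (next i)))  ≡⟨ next-last (opposite (next i)) (trans (opposite-prop (next i)) (cong (r ∸_) (next-last i i≡r))) ⟩
    0                               ≡⟨ sym (ℕₚ.n∸n≡0 r) ⟩
    r ∸ r                           ≡⟨ cong (r ∸_) (sym i≡r) ⟩
    r ∸ toℕ i                       ≡⟨ sym (opposite-prop i) ⟩
    toℕ (opposite i)                ∎
  helper (no i≢r) = begin
    toℕ (next (opposite (next i)))  ≡⟨ next-inner (opposite (next i)) (subst (_< r) (sym opp) (ℕₚ.∸-monoʳ-< (s≤s z≤n) i<r)) ⟩
    suc (toℕ (opposite (next i)))   ≡⟨ cong suc opp ⟩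
    suc (r ∸ suc (toℕ i))           ≡⟨ sym (ℕₚ.+-∸-assoc 1 i<r) ⟩
    r ∸ toℕ i                       ≡⟨ sym (opposite-prop i) ⟩
    toℕ (opposite i)                ∎
    where
    i<r : toℕ i < r
    i<r = ℕₚ.≤∧≢⇒< (toℕ≤pred[n] i) i≢r
    opp : toℕ (opposite (next i)) ≡ r ∸ suc (toℕ i)
    opp = trans (opposite-prop (next i)) (cong (r ∸_) (next-inner i i<r))

next≢prev : 3 ≤ r → (i : Fin r) → next i ≢ prev i
next≢prev {suc (suc (suc k))} (s≤s (s≤s (s≤s z≤n))) i eq = helper (toℕ i ℕₚ.≟ 2 + k) (toℕ (next i) ℕₚ.≟ 2 + k)
  where
  nn : next (next i) ≡ i
  nn = trans (cong next eq) (next-prev i)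
  helper : _ → _ → _
  helper (yes p) (yes q) with () ← trans (sym q) (next-last i p)
  helper (yes p) (no q)  with () ← trans (sym p) (trans (cong toℕ (sym nn))
    (trans (next-inner (next i) (ℕₚ.≤∧≢⇒< (toℕ≤pred[n] (next i)) q)) (cong suc (next-last i p))))
  helper (no p)  (yes q) with () ← trans (sym q) (trans (next-inner i (ℕₚ.≤∧≢⇒< (toℕ≤pred[n] i) p))
    (cong suc (trans (cong toℕ (sym nn)) (next-last (next i) q))))
  helper (no p)  (no q)  = ℕₚ.m≢1+n+m (toℕ i) (trans (cong toℕ (sym nn))
    (trans (next-inner (next i) (ℕₚ.≤∧≢⇒< (toℕ≤pred[n] (next i)) q))
           (cong suc (next-inner i (ℕₚ.≤∧≢⇒< (toℕ≤pred[n] i) p)))))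

-- A cyclic sequence (v₀ , … , v_{r-1}).  It presents both a directed
-- cycle (a directed subgraph, up to _≈→_) and the underlying undirected
-- cycle (a subgraph, up to _≈_).
record Cycle (Γ : Graph n) : Set where
  open Graph Γ
  field
    len      : ℕ
    3≤len    : 3 ≤ len
    vtx      : Fin len → Fin n
    distinct : Injective _≡_ _≡_ vtx
    adjacent : ∀ i → Adj (vtx i) (vtx (next i))

module _ {Γ : Graph n} where
  open Graph Γ
  open Cycle

  HasArc : Cycle Γ → Rel (Fin n) 0ℓ
  HasArc C u v = ∃[ i ] vtx C i ≡ u × vtx C (next i) ≡ v

  HasEdge : Cycle Γ → Rel (Fin n) 0ℓ
  HasEdge C u v = HasArc C u v ⊎ HasArc C v u

  infix 4 _≈→_ _≈_

  _≈→_ : Rel (Cycle Γ) 0ℓ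
  C ≈→ D = ∀ u v → HasArc C u v ⇔ HasArc D u v

  record _≈_ (C D : Cycle Γ) : Set where
    constructor mk≈
    field edges : ∀ u v → HasEdge C u v ⇔ HasEdge D u v

  reverse : Cycle Γ → Cycle Γ
  reverse C = record
    { len      = len C
    ; 3≤len    = 3≤len C
    ; vtx      = vtx C ∘ opposite
    ; distinct = λ {i} {j} eq → trans (sym (opposite-involutive i))
                   (trans (cong opposite (distinct C eq)) (opposite-involutive j))
    ; adjacent = λ i → adjSym (subst (λ j → Adj (vtx C (opposite (next i))) (vtx C j))
                   (next-opposite-next i) (adjacent C (opposite (next i))))
    }

  infixr 20 _•_

  _•_ : Automorphism Γ → Cycle Γ → Cycle Γ
  g • C = record
    { len      = len C
    ; 3≤len    = 3≤len C
    ; vtx      = λ i → g · vtx C i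
    ; distinct = λ eq → distinct C (trans (sym (Perm.inverseˡ π)) (trans (cong (π Perm.⟨$⟩ˡ_) eq) (Perm.inverseˡ π)))
    ; adjacent = λ i → to (Automorphism.preserves g) (adjacent C i)
    }
    where π = Automorphism.perm g

  open _≈_ public

  ≈-refl : ∀ {C} → C ≈ C
  ≈-refl = mk≈ λ _ _ → mk⇔ (λ e → e) (λ e → e)

  ≈-sym : ∀ {C D} → C ≈ D → D ≈ C
  ≈-sym p = mk≈ λ u v → mk⇔ (from (edges p u v)) (to (edges p u v))

  ≈-trans : ∀ {C D E} → C ≈ D → D ≈ E → C ≈ E
  ≈-trans p q = mk≈ λ u v → mk⇔ (to (edges q u v) ∘ to (edges p u v)) (from (edges p u v) ∘ from (edges q u v))

  •-hasEdge : ∀ g C {u v} → HasEdge C u v → HasEdge (g • C) (g · u) (g · v)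
  •-hasEdge g C = Sum.map (arc _ _) (arc _ _)
    where
    arc : ∀ u v → HasArc C u v → HasArc (g • C) (g · u) (g · v)
    arc u v (i , p , q) = i , cong (g ·_) p , cong (g ·_) q

  ε-• : ∀ F → (Group.ε (Aut Γ) • F) ≈ F
  ε-• F = mk≈ λ _ _ → mk⇔ (λ e → e) (λ e → e)

  ∙-• : ∀ g h F → (Group._∙_ (Aut Γ) g h • F) ≈ (g • h • F)
  ∙-• g h F = mk≈ λ _ _ → mk⇔ (λ e → e) (λ e → e)

  •-cong : ∀ {g h} F → g ≈ᵃ h → (g • F) ≈ (h • F)
  •-cong {g} {h} F g≈h = mk≈ λ u v → mk⇔ (Sum.map (arc g h g≈h u v) (arc g h g≈h v u))
                                          (Sum.map (arc h g h≈g u v) (arc h g h≈g v u))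
    where
    h≈g : h ≈ᵃ g
    h≈g x = sym (g≈h x)
    arc : ∀ g h → g ≈ᵃ h → ∀ u v → HasArc (g • F) u v → HasArc (h • F) u v
    arc g h p u v (i , x , y) = i , trans (sym (p _)) x , trans (sym (p _)) y

  hasEdge⇒adj : ∀ C {u v} → HasEdge C u v → Adj u v
  hasEdge⇒adj C (inj₁ (i , refl , refl)) = adjacent C i
  hasEdge⇒adj C (inj₂ (i , refl , refl)) = adjSym (adjacent C i)

  cycle-neighbours : ∀ C i {w} → HasEdge C (vtx C i) w →
    w ≡ vtx C (next i) ⊎ w ≡ vtx C (prev i)
  cycle-neighbours C i (inj₁ (j , p , refl)) = inj₁ (cong (vtx C ∘ next) (distinct C p))
  cycle-neighbours C i (inj₂ (j , refl , q)) =
    inj₂ (cong (vtx C) (trans (sym (prev-next j)) (cong prev (distinct C q))))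

  other-neighbour : ∀ C {v w} → HasEdge C v w →
    ∃[ w′ ] HasEdge C v w′ × w ≢ w′ × (∀ {x} → HasEdge C v x → x ≢ w → w′ ≡ x)
  other-neighbour C (inj₁ (i , refl , refl)) =
    vtx C (prev i) , inj₂ (prev i , refl , cong (vtx C) (next-prev i)) ,
    (λ eq → next≢prev (3≤len C) i (distinct C eq)) ,
    λ e x≢ → Sum.[ (λ x≡ → ⊥-elim (x≢ x≡)) , sym ]′ (cycle-neighbours C i e)
  other-neighbour C (inj₂ (i , refl , refl)) =
    vtx C (next (next i)) , inj₁ (next i , refl , refl) ,
    (λ eq → next≢prev (3≤len C) (next i) (trans (sym (distinct C eq)) (sym (prev-next i)))) ,
    λ e x≢ → Sum.[ sym , (λ x≡ → ⊥-elim (x≢ (trans x≡ (cong (vtx C) (prev-next i))))) ]′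
               (cycle-neighbours C (next i) e)

  module _ (G : Subgroup (Aut Γ)) where

    DirectedConsistent : Pred (Cycle Γ) 0ℓ
    DirectedConsistent C = ∃[ g ] g ∈ carrier G × (∀ i → g · vtx C i ≡ vtx C (next i))

    Consistent : Pred (Cycle Γ) 0ℓ
    Consistent C = DirectedConsistent C × DirectedConsistent (reverse C)

    SymmetricConsistent : Pred (Cycle Γ) 0ℓ
    SymmetricConsistent C = Consistent C × ∃[ g ] g ∈ carrier G × (g • C) ≈→ reverse C

    -- The orbit of the undirected cycle presented by C.
    OrbitOf : Cycle Γ → Pred (Cycle Γ) 0ℓ
    OrbitOf C D = ∃[ g ] g ∈ carrier G × (g • C) ≈ D

    AllOrbitsSymmetric : Set
    AllOrbitsSymmetric = ∀ C → Consistent C → OrbitOf C ⊆ SymmetricConsistent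

-- A polytopal map on a closed surface is encoded by its set of face
-- boundaries.  These are cycles (no vertex repeats on a face), every edge
-- lies on exactly two of them, and the link of every vertex is connected;
-- since by the edge condition the link is 2-regular, it is then a single
-- cycle.  These are precisely the conditions under which gluing a disc
-- along each face boundary yields a closed surface.  Identifying faces with
-- their boundaries only excludes the map with two faces on a cycle graph.
record Map (Γ : Graph n) : Set₁ where
  open Graph Γ
  field
    connected : Connected
    Face      : Pred (Cycle Γ) 0ℓ
    face-resp : Face Respects _≈_
    two-faces : ∀ {u v} → Adj u v → ∃₂ λ F₁ F₂ →
      (F₁ ∈ Face × HasEdge F₁ u v) ×
      (F₂ ∈ Face × HasEdge F₂ u v) ×
      ¬ (F₁ ≈ F₂) ×
      (∀ {F} → F ∈ Face → HasEdge F u v → F ≈ F₁ ⊎ F ≈ F₂)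

  Corner : Fin n → Rel (Fin n) 0ℓ
  Corner v a b = a ≢ b × ∃[ F ] F ∈ Face × HasEdge F v a × HasEdge F v b

  field
    link-connected : ∀ {v a b} → Adj v a → Adj v b → Star (Corner v) a b

module _ {Γ : Graph n} where
  open Graph Γ

  AutMap : Map Γ → Subgroup (Aut Γ)
  AutMap M = record
    { carrier = λ g → ∀ F → F ∈ Face ⇔ (g • F) ∈ Face
    ; resp    = λ {g} {h} g≈h g∈ F → mk⇔
        (λ f → face-resp (•-cong {g = g} {h = h} F g≈h) (to (g∈ F) f))
        (λ f → from (g∈ F) (face-resp (≈-sym (•-cong {g = g} {h = h} F g≈h)) f))
    ; ε∈      = λ F → mk⇔ (face-resp (≈-sym (ε-• F))) (face-resp (ε-• F))
    ; ∙∈      = λ {g} {h} g∈ h∈ F → mk⇔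
        (λ f → face-resp (≈-sym (∙-• g h F)) (to (g∈ (h • F)) (to (h∈ F) f)))
        (λ f → from (h∈ F) (from (g∈ (h • F)) (face-resp (∙-• g h F) f)))
    ; ⁻¹∈     = λ {g} g∈ F → mk⇔
        (λ f → from (g∈ ((g ⁻¹) • F)) (face-resp (≈-sym (cancel g F)) f))
        (λ f → face-resp (cancel g F) (to (g∈ ((g ⁻¹) • F)) f))
    }
    where
    open Map M
    open Group (Aut Γ) using (_∙_; ε; _⁻¹; inverseʳ)

    cancel : ∀ g F → (g • (g ⁻¹) • F) ≈ F
    cancel g F = ≈-trans (≈-sym (∙-• g (g ⁻¹) F))
                   (≈-trans (•-cong {g = g ∙ g ⁻¹} {h = ε} F (inverseʳ g)) (ε-• F))

module _ {Γ : Graph n} (M : Map Γ) where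
  open Graph Γ
  open Map M

  -- An incident triple: a vertex, the edge {vertex , end} and a face.
  record Flag : Set where
    field
      vertex end : Fin n
      face       : Cycle Γ
      isFace     : face ∈ Face
      onFace     : HasEdge face vertex end

module _ {Γ : Graph n} {M : Map Γ} where
  open Graph Γ
  open Map M
  open Flag

  SameEdge : Rel (Flag M) 0ℓ
  SameEdge Φ Ψ = (vertex Φ ≡ vertex Ψ × end Φ ≡ end Ψ) ⊎ (vertex Φ ≡ end Ψ × end Φ ≡ vertex Ψ)

  infix 4 _≈ᶠ_

  _≈ᶠ_ : Rel (Flag M) 0ℓ
  Φ ≈ᶠ Ψ = vertex Φ ≡ vertex Ψ × SameEdge Φ Ψ × face Φ ≈ face Ψ

  DiffersExactlyIn : Fin 3 → Rel (Flag M) 0ℓ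
  DiffersExactlyIn 0F Φ Ψ = vertex Φ ≢ vertex Ψ × SameEdge Φ Ψ × face Φ ≈ face Ψ
  DiffersExactlyIn 1F Φ Ψ = vertex Φ ≡ vertex Ψ × ¬ SameEdge Φ Ψ × face Φ ≈ face Ψ
  DiffersExactlyIn 2F Φ Ψ = vertex Φ ≡ vertex Ψ × SameEdge Φ Ψ × ¬ (face Φ ≈ face Ψ)

  private
    vertex≢end : ∀ (Φ : Flag M) → vertex Φ ≢ end Φ
    vertex≢end Φ eq = adjIrr eq (hasEdge⇒adj (face Φ) (onFace Φ))

    sameEdge⇒end : ∀ Φ Ψ → vertex Φ ≡ vertex Ψ → SameEdge Φ Ψ → end Φ ≡ end Ψ
    sameEdge⇒end Φ Ψ v≡ (inj₁ (_ , e≡)) = e≡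
    sameEdge⇒end Φ Ψ v≡ (inj₂ (_ , e≡)) = ⊥-elim (vertex≢end Φ (trans v≡ (sym e≡)))

    transport : ∀ {u v u′ v′} {C : Cycle Γ} → u ≡ u′ → v ≡ v′ → HasEdge C u v → HasEdge C u′ v′
    transport refl refl e = e

  adjacent-flag : ∀ i Φ → ∃! _≈ᶠ_ (DiffersExactlyIn i Φ)
  adjacent-flag 0F Φ = Φ⁰ , (vertex≢end Φ , inj₂ (refl , refl) , ≈-refl) , λ {Ψ} → unique {Ψ}
    where
    Φ⁰ : Flag M
    Φ⁰ = record { vertex = end Φ ; end = vertex Φ ; face = face Φ
                ; isFace = isFace Φ ; onFace = swap (onFace Φ) }
    unique : ∀ {Ψ} → DiffersExactlyIn 0F Φ Ψ → Φ⁰ ≈ᶠ Ψ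
    unique {Ψ} (v≢ , inj₁ (v≡ , _)  , f≈) = ⊥-elim (v≢ v≡)
    unique {Ψ} (v≢ , inj₂ (v≡ , e≡) , f≈) = e≡ , inj₁ (e≡ , v≡) , f≈
  adjacent-flag 1F Φ = Φ¹ , (refl , distinctEdge , ≈-refl) , λ {Ψ} → unique {Ψ}
    where
    other = other-neighbour (face Φ) (onFace Φ)
    Φ¹ : Flag M
    Φ¹ = record { vertex = vertex Φ ; end = proj₁ other ; face = face Φ
                ; isFace = isFace Φ ; onFace = proj₁ (proj₂ other) }
    distinctEdge : ¬ SameEdge Φ Φ¹
    distinctEdge s = proj₁ (proj₂ (proj₂ other)) (sameEdge⇒end Φ Φ¹ refl s)
    unique : ∀ {Ψ} → DiffersExactlyIn 1F Φ Ψ → Φ¹ ≈ᶠ Ψ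
    unique {Ψ} (v≡ , e≢ , f≈) = v≡ , inj₁ (v≡ , proj₂ (proj₂ (proj₂ other))
      (from (edges f≈ _ _) (transport {C = face Ψ} (sym v≡) refl (onFace Ψ)))
      (λ e≡ → e≢ (inj₁ (v≡ , sym e≡)))) , f≈
  adjacent-flag 2F Φ with two-faces (hasEdge⇒adj (face Φ) (onFace Φ))
  ... | F₁ , F₂ , (f₁ , e₁) , (f₂ , e₂) , F₁≉F₂ , exhaust with exhaust (isFace Φ) (onFace Φ)
  ...   | inj₁ F≈F₁ = Φ² , (refl , inj₁ (refl , refl) , λ F≈F₂ → F₁≉F₂ (≈-trans (≈-sym F≈F₁) F≈F₂)) , λ {Ψ} → unique {Ψ}
    where
    Φ² : Flag M
    Φ² = record { vertex = vertex Φ ; end = end Φ ; face = F₂ ; isFace = f₂ ; onFace = e₂ }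
    unique : ∀ {Ψ} → DiffersExactlyIn 2F Φ Ψ → Φ² ≈ᶠ Ψ
    unique {Ψ} (v≡ , s , f≉) with exhaust (isFace Ψ)
      (transport {C = face Ψ} (sym v≡) (sym (sameEdge⇒end Φ Ψ v≡ s)) (onFace Ψ))
    ... | inj₁ Ψ≈F₁ = ⊥-elim (f≉ (≈-trans F≈F₁ (≈-sym Ψ≈F₁)))
    ... | inj₂ Ψ≈F₂ = v≡ , s , ≈-sym Ψ≈F₂
  ...   | inj₂ F≈F₂ = Φ² , (refl , inj₁ (refl , refl) , λ F≈F₁ → F₁≉F₂ (≈-trans (≈-sym F≈F₁) F≈F₂)) , λ {Ψ} → unique {Ψ}
    where
    Φ² : Flag M
    Φ² = record { vertex = vertex Φ ; end = end Φ ; face = F₁ ; isFace = f₁ ; onFace = e₁ }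
    unique : ∀ {Ψ} → DiffersExactlyIn 2F Φ Ψ → Φ² ≈ᶠ Ψ
    unique {Ψ} (v≡ , s , f≉) with exhaust (isFace Ψ)
      (transport {C = face Ψ} (sym v≡) (sym (sameEdge⇒end Φ Ψ v≡ s)) (onFace Ψ))
    ... | inj₁ Ψ≈F₁ = v≡ , s , ≈-sym Ψ≈F₁
    ... | inj₂ Ψ≈F₂ = ⊥-elim (f≉ (≈-trans F≈F₂ (≈-sym Ψ≈F₂)))

  infixl 30 _^_

  _^_ : Flag M → Fin 3 → Flag M
  Φ ^ i = proj₁ (adjacent-flag i Φ)

  act : (g : Automorphism Γ) → g ∈ carrier (AutMap M) → Flag M → Flag M
  act g g∈ Φ = record
    { vertex = g · vertex Φ
    ; end    = g · end Φ
    ; face   = g • face Φ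
    ; isFace = to (g∈ (face Φ)) (isFace Φ)
    ; onFace = •-hasEdge g (face Φ) (onFace Φ)
    }

  SameOrbit : Rel (Flag M) 0ℓ
  SameOrbit Φ Ψ = ∃[ g ] Σ (g ∈ carrier (AutMap M)) λ g∈ → act g g∈ Φ ≈ᶠ Ψ

module _ {Γ : Graph n} where

  record Class2₀₁ (M : Map Γ) : Set where
    field
      two-orbits : ∃₂ λ (Φ Ψ : Flag M) → ¬ SameOrbit Φ Ψ × (∀ Χ → SameOrbit Φ Χ ⊎ SameOrbit Ψ Χ)
      0-same     : ∀ (Φ : Flag M) → SameOrbit Φ (Φ ^ 0F)
      1-same     : ∀ (Φ : Flag M) → SameOrbit Φ (Φ ^ 1F)
      2-differs  : ∀ (Φ : Flag M) → ¬ SameOrbit Φ (Φ ^ 2F)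

{-# OPTIONS --safe #-}

-- Write g(u,v,w) for the element of G with (u,v) ↦ (v,w).  By regularity on
-- arcs it is the only possible shunt of a consistent cycle through u, v, w, so
-- three consecutive vertices determine a consistent cycle.  Such a cycle is
-- symmetric as soon as the element h of the stabiliser of v with h u = w also
-- has h w = u, because then h conjugates g(u,v,w) to its inverse.
--
-- If a map of class 2_{0,1} has automorphism group G, then the two neighbours
-- forming a corner at v are swapped by an element of the stabiliser G_v.  Had
-- some h in G_v order 4, the only involution of G_v would be h², and the
-- corners at v would only join a to h² a; then the link of v would be
-- disconnected.  So every element of G_v is an involution on the neighbours.
--
-- Conversely, the stabiliser of a symmetric consistent cycle is transitive on
-- its arcs, so by regularity every arc lies on one member of each orbit, and
-- the incident triples on the members of one orbit form a single G-orbit.  At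
-- each vertex the two chosen orbits induce two perfect matchings of the four
-- neighbours; these are disjoint since three consecutive vertices determine a
-- consistent cycle, and the union of two disjoint perfect matchings on four
-- points is connected.
module Submission where

open import Defs
open import Data.Nat.Base using (ℕ; _≤_; _<_; z≤n; s≤s)
open import Data.Product.Base using (Σ; ∃-syntax; _×_; _,_; proj₁; proj₂)
open import Relation.Nullary using (¬_; yes; no)
open import Relation.Unary using (_∈_; _∪_; _≐_; U)

open import Algebra.Bundles using (Group)
open import Data.Empty using (⊥-elim)
open import Data.Fin.Base using (Fin; zero; suc; toℕ; fromℕ; fromℕ<; inject₁; opposite)
open import Data.Fin.Induction using (<-weakInduction; >-weakInduction)
open import Data.Fin.Patterns using (0F; 1F; 2F)
open import Data.Fin.Permutation as Perm using ()
open import Data.Fin.Properties using (_≟_; any?; opposite-involutive; toℕ-injective; toℕ-fromℕ; toℕ-inject₁; toℕ<n)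
open import Data.List.Base using (List; []; _∷_; _++_; length; filter; allFin)
open import Data.List.Membership.Propositional using () renaming (_∈_ to _∈ˡ_)
open import Data.List.Membership.Propositional.Properties
  using (∈-∃++; ∈-++⁺ˡ; ∈-++⁺ʳ; ∈-++⁻; ∈-filter⁺; ∈-filter⁻; ∈-allFin)
open import Data.List.Properties using (length-++-sucʳ)
open import Data.List.Relation.Binary.Subset.Propositional using () renaming (_⊆_ to _⊆ˡ_)
open import Data.List.Relation.Unary.All as All using (All; []; _∷_)
open import Data.List.Relation.Unary.AllPairs using ([]; _∷_)
open import Data.List.Relation.Unary.Any using (here; there)
open import Data.List.Relation.Unary.Unique.Propositional using (Unique)
open import Data.List.Relation.Unary.Unique.Propositional.Properties using (allFin⁺; filter⁺)
import Data.Nat.Properties as ℕₚ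
open import Data.Sum.Base as Sum using (_⊎_; inj₁; inj₂; swap; [_,_]′)
open import Function.Base using (_∘_; id)
open import Function.Bundles using (mk⇔; Equivalence)
open import Relation.Binary.Construct.Closure.ReflexiveTransitive using (Star; _◅_) renaming (ε to stop)
open import Relation.Binary.PropositionalEquality
open import Relation.Nullary.Decidable using (_×-dec_; ¬?)

open Equivalence using (to; from)

-- Counting in duplicate-free lists and induction around a cycle.

Unique-⊆⇒length≤ : ∀ {A : Set} {xs ys : List A} → Unique xs → xs ⊆ˡ ys → length xs ≤ length ys
Unique-⊆⇒length≤ []                   _     = z≤n
Unique-⊆⇒length≤ {xs = x ∷ xs} (x∉ ∷ u) xs⊆ys with ∈-∃++ (xs⊆ys (here refl))
... | as , bs , refl = subst (_ ≤_) (sym (length-++-sucʳ as x bs)) (s≤s (Unique-⊆⇒length≤ u xs⊆rest))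
  where
  xs⊆rest : xs ⊆ˡ as ++ bs
  xs⊆rest {y} y∈xs with ∈-++⁻ as (xs⊆ys (there y∈xs))
  ... | inj₁ y∈as         = ∈-++⁺ˡ y∈as
  ... | inj₂ (here y≡x)   = ⊥-elim (All.lookup x∉ y∈xs (sym y≡x))
  ... | inj₂ (there y∈bs) = ∈-++⁺ʳ as y∈bs

-- One climb leads from `i₀` to the last index; `next` of that is `zero`, and a second climb from
-- `zero` reaches every index.
cyclic-induction : ∀ {r} (P : Fin r → Set) (i₀ : Fin r) → P i₀ → (∀ i → P i → P (next i)) → ∀ i → P i
cyclic-induction {ℕ.suc r} P i₀ base step = <-weakInduction P P-zero upward
  where
  next-inject₁ : (i : Fin r) → next (inject₁ i) ≡ suc i
  next-inject₁ i = toℕ-injective (trans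
    (next-inner (inject₁ i) (subst (_< r) (sym (toℕ-inject₁ i)) (toℕ<n i)))
    (cong ℕ.suc (toℕ-inject₁ i)))
  upward : ∀ i → P (inject₁ i) → P (suc i)
  upward i p = subst P (next-inject₁ i) (step (inject₁ i) p)
  P-last : P (fromℕ r)
  P-last = >-weakInduction (λ i → P i → P (fromℕ r)) id (λ i f → f ∘ upward i) i₀ base
  P-zero : P zero
  P-zero = subst P (toℕ-injective (next-last (fromℕ r) (toℕ-fromℕ r))) (step (fromℕ r) P-last)

-- Action of automorphisms on vertices and arcs.

module _ {n : ℕ} {Γ : Graph n} where
  open Graph Γ
  open Cycle
  open Group (Aut Γ) using (_∙_; ε; _⁻¹)

  ⁻¹-cancelˡ : ∀ (g : Automorphism Γ) v → (g ⁻¹) · g · v ≡ v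
  ⁻¹-cancelˡ g v = Perm.inverseˡ (Automorphism.perm g)

  ·-injective : ∀ (g : Automorphism Γ) {u v} → g · u ≡ g · v → u ≡ v
  ·-injective g {u} {v} eq = trans (sym (⁻¹-cancelˡ g u)) (trans (cong ((g ⁻¹) ·_) eq) (⁻¹-cancelˡ g v))

  ·≡⇒⁻¹· : ∀ (g : Automorphism Γ) {u v} → g · u ≡ v → (g ⁻¹) · v ≡ u
  ·≡⇒⁻¹· g {u} eq = trans (cong ((g ⁻¹) ·_) (sym eq)) (⁻¹-cancelˡ g u)

  ·-adj : ∀ (g : Automorphism Γ) {u v} → Adj u v → Adj (g · u) (g · v)
  ·-adj g = to (Automorphism.preserves g)

  -- Arcs of cycles

  origin : (C : Cycle Γ) → Fin (len C)
  origin C = fromℕ< (ℕₚ.≤-trans (s≤s z≤n) (3≤len C))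

  start second : Cycle Γ → Fin n
  start  C = vtx C (origin C)
  second C = vtx C (next (origin C))

  start-arc : ∀ C → HasArc C (start C) (second C)
  start-arc C = origin C , refl , refl

  start-adj : ∀ C → Adj (start C) (second C)
  start-adj C = adjacent C (origin C)

  hasArc-functional : ∀ (C : Cycle Γ) {u v w} → HasArc C u v → HasArc C u w → v ≡ w
  hasArc-functional C (i , p , refl) (j , q , refl) = cong (vtx C ∘ next) (distinct C (trans p (sym q)))

  hasArc-injective : ∀ (C : Cycle Γ) {u v w} → HasArc C u w → HasArc C v w → u ≡ v
  hasArc-injective C (i , refl , p) (j , refl , q) = cong (vtx C)
    (trans (sym (prev-next i)) (trans (cong prev (distinct C (trans p (sym q)))) (prev-next j)))

  no-two-cycle : ∀ (C : Cycle Γ) i → vtx C (next (next i)) ≢ vtx C i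
  no-two-cycle C i eq = next≢prev (3≤len C) i (trans (sym (prev-next (next i))) (cong prev (distinct C eq)))

  hasArc-asym : ∀ (C : Cycle Γ) {u v} → HasArc C u v → ¬ HasArc C v u
  hasArc-asym C (i , refl , refl) back =
    no-two-cycle C i (hasArc-functional C (next i , refl , refl) back)

  hasArc-reverse : ∀ (C : Cycle Γ) {u v} → HasArc C u v → HasArc (reverse C) v u
  hasArc-reverse C (i , refl , refl) = opposite (next i) ,
    cong (vtx C) (opposite-involutive (next i)) ,
    cong (vtx C) (trans (cong opposite (next-opposite-next i)) (opposite-involutive i))


  hasArc-unreverse : ∀ (C : Cycle Γ) {u v} → HasArc (reverse C) v u → HasArc C u v
  hasArc-unreverse C (j , refl , refl) = opposite (next j) , refl , cong (vtx C) (next-opposite-next j)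

  reverse-≈ : ∀ (C : Cycle Γ) → reverse C ≈ C
  reverse-≈ C = mk≈ λ _ _ → mk⇔
    (swap ∘ Sum.map (hasArc-unreverse C) (hasArc-unreverse C))
    (swap ∘ Sum.map (hasArc-reverse C) (hasArc-reverse C))

  ≈→⇒≈ : ∀ {C D : Cycle Γ} → C ≈→ D → C ≈ D
  ≈→⇒≈ e = mk≈ λ u v → mk⇔ (Sum.map (to (e u v)) (to (e v u))) (Sum.map (from (e u v)) (from (e v u)))

  -- Orientation spreads along `D` from the common arc: if `C` ran the next edge backwards, it would
  -- have two arcs into one vertex, and `D` would return to a vertex after two steps.
  ≈-common-arc⇒≈→ : ∀ {C D : Cycle Γ} → C ≈ D → HasArc C (start D) (second D) → C ≈→ D
  ≈-common-arc⇒≈→ {C} {D} C≈D base u v = mk⇔ C⊆D (D⊆C u v)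
    where
    along : ∀ i → HasArc C (vtx D i) (vtx D (next i))
    along = cyclic-induction _ (origin D) base λ i arc →
      [ id , (λ back → ⊥-elim (no-two-cycle D i (hasArc-injective C back arc))) ]′
        (from (edges C≈D _ _) (inj₁ (next i , refl , refl)))
    D⊆C : ∀ u v → HasArc D u v → HasArc C u v
    D⊆C _ _ (i , refl , refl) = along i
    C⊆D : HasArc C u v → HasArc D u v
    C⊆D arc = [ id , (λ back → ⊥-elim (hasArc-asym C arc (D⊆C v u back))) ]′ (to (edges C≈D u v) (inj₁ arc))

  ≈⇒≈→ : ∀ {C D : Cycle Γ} → C ≈ D → C ≈→ D ⊎ reverse C ≈→ D
  ≈⇒≈→ {C} {D} C≈D with from (edges C≈D _ _) (inj₁ (start-arc D))
  ... | inj₁ arc  = inj₁ (≈-common-arc⇒≈→ {C} {D} C≈D arc)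
  ... | inj₂ back = inj₂ (≈-common-arc⇒≈→ {reverse C} {D} (≈-trans (reverse-≈ C) C≈D) (hasArc-reverse C back))

  two-edges-determine : ∀ (C : Cycle Γ) {v a b c} → HasEdge C v a → HasEdge C v b → HasEdge C v c →
    b ≢ a → c ≢ a → b ≡ c
  two-edges-determine C va vb vc b≢a c≢a with other-neighbour C va
  ... | _ , _ , _ , unique = trans (sym (unique vb b≢a)) (unique vc c≢a)

  hasEdge-• : ∀ g (C : Cycle Γ) {u v} → HasEdge (g • C) (g · u) (g · v) → HasEdge C u v
  hasEdge-• g C = Sum.map arc arc
    where
    arc : ∀ {u v} → HasArc (g • C) (g · u) (g · v) → HasArc C u v
    arc (i , p , q) = i , ·-injective g p , ·-injective g q

  •-⊆ : ∀ g {C D : Cycle Γ} → C ≈ D → ∀ {u v} → HasEdge (g • C) u v → HasEdge (g • D) u v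
  •-⊆ g {C} {D} C≈D (inj₁ (i , refl , refl)) = •-hasEdge g D (to (edges C≈D _ _) (inj₁ (i , refl , refl)))
  •-⊆ g {C} {D} C≈D (inj₂ (i , refl , refl)) = •-hasEdge g D (to (edges C≈D _ _) (inj₂ (i , refl , refl)))

  •-resp : ∀ g {C D : Cycle Γ} → C ≈ D → (g • C) ≈ (g • D)
  •-resp g {C} {D} C≈D = mk≈ λ _ _ → mk⇔ (•-⊆ g {C} {D} C≈D) (•-⊆ g {D} {C} (≈-sym C≈D))

  •-cancel : ∀ g {C D : Cycle Γ} → (g • C) ≈ (g • D) → C ≈ D
  •-cancel g {C} {D} eq = mk≈ λ u v → mk⇔
    (hasEdge-• g D ∘ to (edges eq _ _) ∘ •-hasEdge g C)
    (hasEdge-• g C ∘ from (edges eq _ _) ∘ •-hasEdge g D)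

  ⁻¹-•-• : ∀ g (C : Cycle Γ) → ((g ⁻¹) • g • C) ≈ C
  ⁻¹-•-• g C = ≈-trans (≈-sym (∙-• (g ⁻¹) g C))
    (≈-trans (•-cong {g = g ⁻¹ ∙ g} {h = ε} C (⁻¹-cancelˡ g)) (ε-• C))

  -- Shunts

  Shunt : Automorphism Γ → Cycle Γ → Set
  Shunt s C = ∀ i → s · vtx C i ≡ vtx C (next i)

  shunt-arc : ∀ {s C} → Shunt s C → ∀ {u v} → HasArc C u v → s · u ≡ v
  shunt-arc sh (i , refl , refl) = sh i

  arc⇒shunt : ∀ {s C} → (∀ {u v} → HasArc C u v → s · u ≡ v) → Shunt s C
  arc⇒shunt f i = f (i , refl , refl)

  shunt-reverse : ∀ {s C} → Shunt s C → Shunt (s ⁻¹) (reverse C)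
  shunt-reverse {s} {C} sh = arc⇒shunt {s ⁻¹} {reverse C}
    λ arc → ·≡⇒⁻¹· s (shunt-arc {s} {C} sh (hasArc-unreverse C arc))

  shunt-• : ∀ {s C} h → Shunt s C → Shunt (h ∙ (s ∙ h ⁻¹)) (h • C)
  shunt-• {s} {C} h sh i = cong (h ·_) (trans (cong (s ·_) (⁻¹-cancelˡ h (vtx C i))) (sh i))

  shunt-≈→ : ∀ {s C D} → C ≈→ D → Shunt s C → Shunt s D
  shunt-≈→ {s} {C} {D} C≈D sh = arc⇒shunt {s} {D} λ arc → shunt-arc {s} {C} sh (from (C≈D _ _) arc)

  shunt-≈ : ∀ {s C} → Shunt s C → (s • C) ≈ C
  shunt-≈ {s} {C} sh = ≈→⇒≈ {s • C} {C} λ _ _ → mk⇔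
    (λ { (i , refl , refl) → next i , sym (sh i) , sym (sh (next i)) })
    (λ { (i , refl , refl) → prev i ,
           trans (sh (prev i)) (cong (vtx C) (next-prev i)) ,
           trans (sh (next (prev i))) (cong (vtx C ∘ next) (next-prev i)) })

  -- Iterating its shunt rebuilds a cycle from any one vertex, so the common vertex puts each vertex
  -- of `C`, together with its successor, on `D`.
  same-shunt-⊆ : ∀ {s t C D} → Shunt s C → Shunt t D → s ≈ᵃ t → ∀ {i j} → vtx C i ≡ vtx D j →
    ∀ {u v} → HasArc C u v → HasArc D u v
  same-shunt-⊆ {s} {t} {C} {D} sC tD s≈t {i} {j} meet {u} {v} (k , p , q) = arc (onD k)
    where
    advance : ∀ {i j} → vtx C i ≡ vtx D j → vtx C (next i) ≡ vtx D (next j)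
    advance {i} {j} eq = trans (sym (sC i)) (trans (s≈t _) (trans (cong (t ·_) eq) (tD j)))
    onD : ∀ k → ∃[ l ] vtx C k ≡ vtx D l
    onD = cyclic-induction _ i (j , meet) λ _ (l , eq) → next l , advance eq
    arc : ∃[ l ] vtx C k ≡ vtx D l → HasArc D u v
    arc (l , eq) = l , trans (sym eq) p , trans (sym (advance eq)) q

  same-shunt : ∀ {s t C D} → Shunt s C → Shunt t D → s ≈ᵃ t → ∀ {i j} → vtx C i ≡ vtx D j → C ≈→ D
  same-shunt {s} {t} {C} {D} sC tD s≈t meet _ _ = mk⇔
    (same-shunt-⊆ {s} {t} {C} {D} sC tD s≈t meet)
    (same-shunt-⊆ {t} {s} {D} {C} tD sC (λ v → sym (s≈t v)) (sym meet))

  -- Counting neighbours in a tetravalent graph.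

  neighbours≤4 : Tetravalent → ∀ {v} {xs : List (Fin n)} → Unique xs → All (Adj v) xs → length xs ≤ 4
  neighbours≤4 tet {v} u adj = subst (_ ≤_) (tet v) (Unique-⊆⇒length≤ u
    λ {x} x∈ → ∈-filter⁺ (adj? v) (∈-allFin x) (All.lookup adj x∈))

  -- Otherwise `x` would be a fifth neighbour of `v`.
  four-neighbours : Tetravalent → ∀ {v a b c d} → Adj v a → Adj v b → Adj v c → Adj v d →
    a ≢ b → a ≢ c → a ≢ d → b ≢ c → b ≢ d → c ≢ d →
    ∀ {x} → Adj v x → x ≢ a → x ≢ b → x ≢ c → x ≡ d
  four-neighbours tet {d = d} va vb vc vd ab ac ad bc bd cd {x} vx xa xb xc with x ≟ d
  ... | yes x≡d = x≡d
  ... | no  xd  = ⊥-elim (ℕₚ.<-irrefl refl (neighbours≤4 tet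
    ((xa ∷ xb ∷ xc ∷ xd ∷ []) ∷ (ab ∷ ac ∷ ad ∷ []) ∷ (bc ∷ bd ∷ []) ∷ (cd ∷ []) ∷ [] ∷ [])
    (vx ∷ va ∷ vb ∷ vc ∷ vd ∷ [])))

  fourth-neighbour : Tetravalent → ∀ v a b c → ∃[ z ] Adj v z × z ≢ a × z ≢ b × z ≢ c
  fourth-neighbour tet v a b c
    with any? (λ z → adj? v z ×-dec ¬? (z ≟ a) ×-dec ¬? (z ≟ b) ×-dec ¬? (z ≟ c))
  ... | yes found = found
  ... | no  none  = ⊥-elim (ℕₚ.<-irrefl refl (subst (_≤ 3) (tet v)
    (Unique-⊆⇒length≤ (filter⁺ (adj? v) (allFin⁺ n)) λ {z} z∈ → listed z (proj₂ (∈-filter⁻ (adj? v) {xs = allFin n} z∈)))))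
    where
    listed : ∀ z → Adj v z → z ∈ˡ a ∷ b ∷ c ∷ []
    listed z vz with z ≟ a | z ≟ b | z ≟ c
    ... | yes za | _      | _      = here za
    ... | no _   | yes zb | _      = there (here zb)
    ... | no _   | no _   | yes zc = there (there (here zc))
    ... | no za  | no zb  | no zc  = ⊥-elim (none (z , vz , za , zb , zc))

  -- Consistent cycles and their orbits.

  module _ (G : Subgroup (Aut Γ)) where
    open Subgroup G using (∙∈; ε∈; ⁻¹∈)

    directed⇒consistent : ∀ {C} → DirectedConsistent G C → Consistent G C
    directed⇒consistent {C} (s , s∈ , sh) = (s , s∈ , sh) , (s ⁻¹ , ⁻¹∈ s∈ , shunt-reverse {s} {C} sh)

    consistent-≈ : ∀ {C D} → C ≈ D → Consistent G C → Consistent G D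
    consistent-≈ {C} {D} C≈D ((s , s∈ , sh) , (t , t∈ , th)) with ≈⇒≈→ C≈D
    ... | inj₁ C≈→D = directed⇒consistent {D} (s , s∈ , shunt-≈→ {s} {C} {D} C≈→D sh)
    ... | inj₂ R≈→D = directed⇒consistent {D} (t , t∈ , shunt-≈→ {t} {reverse C} {D} R≈→D th)

    consistent-• : ∀ {C h} → h ∈ carrier G → Consistent G C → Consistent G (h • C)
    consistent-• {C} {h} h∈ ((s , s∈ , sh) , _) =
      directed⇒consistent {h • C} (h ∙ (s ∙ h ⁻¹) , ∙∈ h∈ (∙∈ s∈ (⁻¹∈ h∈)) , shunt-• {s} {C} h sh)

    orbit-consistent : ∀ {C D} → Consistent G C → D ∈ OrbitOf G C → Consistent G D
    orbit-consistent {C} cons (g , g∈ , gC≈D) = consistent-≈ gC≈D (consistent-• {C} {g} g∈ cons)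

    orbit-refl : ∀ C → C ∈ OrbitOf G C
    orbit-refl C = ε , ε∈ , ε-• C

    orbit-≈ : ∀ {C D E} → D ≈ E → D ∈ OrbitOf G C → E ∈ OrbitOf G C
    orbit-≈ D≈E (g , g∈ , eq) = g , g∈ , ≈-trans eq D≈E

    orbit-• : ∀ {C D h} → h ∈ carrier G → D ∈ OrbitOf G C → (h • D) ∈ OrbitOf G C
    orbit-• {C} {D} {h} h∈ (g , g∈ , eq) = h ∙ g , ∙∈ h∈ g∈ , ≈-trans (∙-• h g C) (•-resp h {g • C} {D} eq)

    orbit-unmove : ∀ {C D h} → h ∈ carrier G → (h • D) ∈ OrbitOf G C → D ∈ OrbitOf G C
    orbit-unmove {C} {D} {h} h∈ o = orbit-≈ {C} (⁻¹-•-• h D) (orbit-• {C} {h • D} {h ⁻¹} (⁻¹∈ h∈) o)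

    -- Used in the contrapositive: cycles in different orbits are never equal.
    orbits-meet : ∀ {C D F} → F ∈ OrbitOf G C → F ∈ OrbitOf G D → D ∈ OrbitOf G C
    orbits-meet {C} {D} o (h , h∈ , hD≈F) = orbit-unmove {C} {D} {h} h∈ (orbit-≈ {C} (≈-sym hD≈F) o)

    -- Rigidity from regularity on arcs.

    module _ (reg : ArcRegular G) where

      arc-transitive : ∀ {u v u′ v′} → Adj u v → Adj u′ v′ →
        ∃[ g ] g ∈ carrier G × g · u ≡ u′ × g · v ≡ v′
      arc-transitive a a′ with reg a a′
      ... | g , props , _ = g , props

      -- Both elements carry the arc from `u` to `v` to the same arc, and `reg` allows only one such
      -- element.
      rigid : ∀ {u v g h} → Adj u v → g ∈ carrier G → h ∈ carrier G → g · u ≡ h · u → g · v ≡ h · v → g ≈ᵃ h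
      rigid {u} {v} {g} {h} a g∈ h∈ gu gv x with reg a (·-adj g a)
      ... | k , _ , unique = trans (sym (unique {g} (g∈ , refl , refl) x)) (unique {h} (h∈ , sym gu , sym gv) x)

      fixed-arc⇒trivial : ∀ {v a h} → Adj v a → h ∈ carrier G → h · v ≡ v → h · a ≡ a → ∀ x → h · x ≡ x
      fixed-arc⇒trivial {h = h} va h∈ hv ha = rigid {g = h} {h = ε} va h∈ ε∈ hv ha

      -- Both shunts send the arc from `u` to `v` to the arc from `v` to `w`, so `rigid` makes them
      -- equal, and equal shunts with a common vertex give equal cycles.
      two-arcs-determine : ∀ {C D u v w} → Consistent G C → Consistent G D →
        HasArc C u v → HasArc C v w → HasArc D u v → HasArc D v w → C ≈→ D
      two-arcs-determine {C} {D} ((s , s∈ , sC) , _) ((t , t∈ , tD) , _) Cuv Cvw Duv@(_ , refl , _) Dvw =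
        same-shunt {s} {t} {C} {D} sC tD
          (rigid {g = s} {h = t} (hasEdge⇒adj D (inj₁ Duv)) s∈ t∈
            (trans (shunt-arc {s} {C} sC Cuv) (sym (shunt-arc {t} {D} tD Duv)))
            (trans (shunt-arc {s} {C} sC Cvw) (sym (shunt-arc {t} {D} tD Dvw))))
          (proj₁ (proj₂ Cuv))

      InvolutiveStabilisers : Set
      InvolutiveStabilisers = ∀ {v a h} → Adj v a → h ∈ carrier G → h · v ≡ v → h · h · a ≡ a

      involutive⇒symmetric : InvolutiveStabilisers → ∀ {C} → Consistent G C → SymmetricConsistent G C
      involutive⇒symmetric inv {C} cons@((s , s∈ , sC) , _)
        with h , h∈ , hv , hu ← arc-transitive (adjSym (start-adj C)) (adjacent C (next (origin C)))
        = cons , h , h∈ , same-shunt {h ∙ (s ∙ h ⁻¹)} {s ⁻¹} {h • C} {reverse C}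
            (shunt-• {s} {C} h sC) (shunt-reverse {s} {C} sC)
            -- Both elements send the arc from the third to the second vertex of `C` to the arc from
            -- the second to the first.
            (rigid {g = h ∙ (s ∙ h ⁻¹)} {h = s ⁻¹} (adjSym (adjacent C (next (origin C))))
              (∙∈ h∈ (∙∈ s∈ (⁻¹∈ h∈))) (⁻¹∈ s∈)
              (trans (trans (cong (λ x → h · s · x) (·≡⇒⁻¹· h hu)) (trans (cong (h ·_) (sC o)) hv))
                     (sym (·≡⇒⁻¹· s (sC (next o)))))
              (trans (trans (cong (λ x → h · s · x) (·≡⇒⁻¹· h hv)) (trans (cong (h ·_) (sC (next o))) hw))
                     (sym (·≡⇒⁻¹· s (sC o)))))
            -- The cycles meet at the second vertex of `C`, which `h` fixes; its index in
            -- `reverse C` is `opposite (next o)`.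
            {next o} {opposite (next o)}
            (trans hv (cong (vtx C) (sym (opposite-involutive (next o)))))
        where
        o = origin C
        hw = trans (cong (h ·_) (sym hu)) (inv {h = h} (adjSym (start-adj C)) h∈ hv)

      -- From a map of the class to symmetric orbits.

      module _ (tet : Tetravalent) (M : Map Γ) where
        open Map M

        -- If `h ∙ h` moves `a`, then `h` cycles the four neighbours `a`, `w`, `x`, `y`. Corners at
        -- `v` then never leave the set of `a` and `x`, so no path in the link leads from `a` to
        -- `w`.
        corner-swaps⇒involutive :
          (∀ {v p q} → Corner v p q → ∃[ g ] g ∈ carrier G × g · v ≡ v × g · p ≡ q × g · q ≡ p) →
          InvolutiveStabilisers
        corner-swaps⇒involutive swaps {v} {a} {h} va h∈ hv with h · h · a ≟ a
        ... | yes hha≡a = hha≡a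
        ... | no  x≢a   = ⊥-elim ([ a≢w ∘ sym , x≢w ∘ sym ]′ (reach (inj₁ refl) (link-connected va vw)))
          where
          w = h · a
          x = h · w
          y = h · x
          stab : ∀ {p} → Adj v p → Adj v (h · p)
          stab {p} vp = subst (λ u → Adj u (h · p)) hv (·-adj h vp)
          vw = stab va
          vx = stab vw
          vy = stab vx
          -- A fixed neighbour would make `h` trivial, against `x≢a`.
          free : ∀ {p} → Adj v p → h · p ≢ p
          free vp hp = x≢a (trans (cong (h ·_) (trivial a)) (trivial a))
            where trivial = fixed-arc⇒trivial {h = h} vp h∈ hv hp
          a≢w : a ≢ w
          a≢w eq = free va (sym eq)
          x≢w : x ≢ w
          x≢w = free vw
          y≢x : y ≢ x
          y≢x = free vx
          y≢w : y ≢ w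
          y≢w = x≢a ∘ ·-injective h
          y≢a : y ≢ a
          -- Were `y` equal to `a`, then `h` would permute `a`, `w`, `x` and fix the fourth
          -- neighbour.
          y≢a y≡a with z , vz , z≢a , z≢w , z≢x ← fourth-neighbour tet v a w x =
            free vz (four-neighbours tet va vw vx vz a≢w (x≢a ∘ sym) (z≢a ∘ sym) (x≢w ∘ sym) (z≢w ∘ sym) (z≢x ∘ sym)
              (stab vz)
              (λ hz≡a → z≢x (·-injective h (trans hz≡a (sym y≡a))))
              (z≢a ∘ ·-injective h) (z≢w ∘ ·-injective h))
          among : ∀ {p} → Adj v p → p ≢ a → p ≢ w → p ≢ x → p ≡ y
          among = four-neighbours tet va vw vx vy a≢w (x≢a ∘ sym) (y≢a ∘ sym) (x≢w ∘ sym) (y≢w ∘ sym) (y≢x ∘ sym)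
          hy≡a : h · y ≡ a
          hy≡a with h · y ≟ a
          ... | yes eq = eq
          ... | no  ne = ⊥-elim (free vy (among (stab vy) ne (y≢a ∘ ·-injective h) (y≢w ∘ ·-injective h)))
          inside : Fin n → Set
          inside p = p ≡ a ⊎ p ≡ x
          agree : ∀ {g p} → Adj v p → g ∈ carrier G → g · v ≡ v → g · p ≡ h · p → ∀ q → g · q ≡ h · q
          agree {g} vp g∈ gv gp = rigid {g = g} {h = h} vp g∈ h∈ (trans gv (sym hv)) gp
          -- If `q` were `w` or `y`, then `g` would agree with `h` at one of the two swapped
          -- neighbours, hence everywhere, contradicting its value at the other.
          swap-inside : ∀ {g p q} → inside p → Adj v q → p ≢ q → g ∈ carrier G → g · v ≡ v →
            g · p ≡ q → g · q ≡ p → inside q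
          swap-inside {g} {q = q} (inj₁ refl) vq p≢q g∈ gv gp gq with q ≟ w | q ≟ x
          ... | _        | yes refl = inj₂ refl
          ... | yes refl | no _     = ⊥-elim (x≢a (trans (sym (agree {g} va g∈ gv gp w)) gq))
          ... | no q≢w   | no q≢x with refl ← among vq (p≢q ∘ sym) q≢w q≢x =
            ⊥-elim (y≢w (trans (sym gp) (agree {g} vy g∈ gv (trans gq (sym hy≡a)) a)))
          swap-inside {g} {q = q} (inj₂ refl) vq p≢q g∈ gv gp gq with q ≟ a | q ≟ w
          ... | yes refl | _        = inj₁ refl
          ... | no _     | yes refl = ⊥-elim (y≢w (trans (sym (agree {g} vw g∈ gv gq x)) gp))
          ... | no q≢a   | no q≢w with refl ← among vq q≢a q≢w (p≢q ∘ sym) =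
            ⊥-elim (x≢a (trans (sym gq) (trans (agree {g} vx g∈ gv gp y) hy≡a)))
          reach : ∀ {p q} → inside p → Star (Corner v) p q → inside q
          reach i stop = i
          reach i (corner@(p≢q , F , _ , _ , vq) ◅ rest) with g , g∈ , gv , gp , gq ← swaps corner =
            reach (swap-inside {g} i (hasEdge⇒adj F vq) p≢q g∈ gv gp gq) rest

        -- The element taking `Φ` to `Φ ^ 1F` fixes `v` and `F` but moves the edge to `p`; as `F`
        -- has just two edges at `v`, it exchanges them.
        class2⇒corner-swaps : Class2₀₁ M → carrier (AutMap M) ≐ carrier G →
          ∀ {v p q} → Corner v p q → ∃[ g ] g ∈ carrier G × g · v ≡ v × g · p ≡ q × g · q ≡ p
        class2⇒corner-swaps cls (aut⊆ , _) {v} {p} {q} (p≢q , F , F∈ , vp , vq)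
          = conclude {Φ ^ 1F} (Class2₀₁.1-same cls Φ) (proj₁ (proj₂ (adjacent-flag 1F Φ)))
          where
          Φ : Flag M
          Φ = record { vertex = v ; end = p ; face = F ; isFace = F∈ ; onFace = vp }
          conclude : ∀ {Ψ} → SameOrbit Φ Ψ → DiffersExactlyIn 1F Φ Ψ →
            ∃[ g ] g ∈ carrier G × g · v ≡ v × g · p ≡ q × g · q ≡ p
          conclude {Ψ} (g , g∈ , gv≡ , sameEdge , gF≈) (v≡ , otherEdge , F≈) =
            g , aut⊆ {g} g∈ , gv , gp≡q , gq≡p
            where
            gv : g · v ≡ v
            gv = trans gv≡ (sym v≡)
            gF≈F : (g • F) ≈ F
            gF≈F = ≈-trans gF≈ (≈-sym F≈)
            moved : ∀ {x} → HasEdge F v x → HasEdge F v (g · x)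
            moved {x} vx = subst (λ u → HasEdge F u (g · x)) gv (to (edges gF≈F _ _) (•-hasEdge g F vx))
            gp≢p : g · p ≢ p
            gp≢p gp≡p = otherEdge (subst₂ (λ x y → (x ≡ _ × y ≡ _) ⊎ (x ≡ _ × y ≡ _)) gv gp≡p sameEdge)
            gp≡q : g · p ≡ q
            gp≡q = two-edges-determine F vp (moved vp) vq gp≢p (p≢q ∘ sym)
            gq≡p : g · q ≡ p
            gq≡p = two-edges-determine F vq (moved vq) vp
              (λ gq≡q → p≢q (·-injective g (trans gp≡q (sym gq≡q)))) p≢q

        class2⇒symmetric : Class2₀₁ M → carrier (AutMap M) ≐ carrier G → AllOrbitsSymmetric G
        class2⇒symmetric cls aut≐ C cons {D} o = involutive⇒symmetric
          (corner-swaps⇒involutive (class2⇒corner-swaps cls aut≐)) {D} (orbit-consistent {C} {D} cons o)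

      -- Stabilisers of symmetric consistent cycles.

      rotate-to-start : ∀ {C u v} → Consistent G C → HasArc C u v →
        ∃[ m ] m ∈ carrier G × (m • C) ≈ C × m · u ≡ start C × m · v ≡ second C
      rotate-to-start {C} ((s , s∈ , sh) , _) (i , refl , refl) = rotate i
        where
        rotate : ∀ i → ∃[ m ] m ∈ carrier G × (m • C) ≈ C × m · vtx C i ≡ start C × m · vtx C (next i) ≡ second C
        -- Each step forward from the starting arc is undone by one more factor `s ⁻¹`.
        rotate = cyclic-induction _ (origin C) (ε , ε∈ , ε-• C , refl , refl) λ i (m , m∈ , mC , mu , mv) →
          m ∙ s ⁻¹ , ∙∈ m∈ (⁻¹∈ s∈) ,
          ≈-trans (∙-• m (s ⁻¹) C) (≈-trans (•-resp m {(s ⁻¹) • C} {C}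
            (≈-trans (•-resp (s ⁻¹) {C} {s • C} (≈-sym (shunt-≈ {s} {C} sh))) (⁻¹-•-• s C))) mC) ,
          trans (cong (m ·_) (·≡⇒⁻¹· s (sh i))) mu ,
          trans (cong (m ·_) (·≡⇒⁻¹· s (sh (next i)))) mv

      -- Rotations handle edges met in the direction of `C`; an edge met backwards is first turned
      -- by the reflection `h`.
      symmetric-edge-to-start : ∀ {C u v} → SymmetricConsistent G C → HasEdge C u v →
        ∃[ m ] m ∈ carrier G × (m • C) ≈ C × m · u ≡ start C × m · v ≡ second C
      symmetric-edge-to-start (cons , _) (inj₁ uv) = rotate-to-start cons uv
      symmetric-edge-to-start {C} {u} {v} (cons , h , h∈ , hC) (inj₂ (i , p , q))
        with m , m∈ , mC , mu , mv ← rotate-to-start cons (hasArc-unreverse C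
               (to (hC (h · v) (h · u)) (i , cong (h ·_) p , cong (h ·_) q))) =
        m ∙ h , ∙∈ m∈ h∈ ,
        ≈-trans (∙-• m h C)
          (≈-trans (•-resp m {h • C} {C} (≈-trans (≈→⇒≈ {h • C} {reverse C} hC) (reverse-≈ C))) mC) ,
        mu , mv

      align : ∀ {C D u v} → SymmetricConsistent G C → D ∈ OrbitOf G C → HasEdge D u v →
        ∃[ k ] k ∈ carrier G × (k • D) ≈ C × k · u ≡ start C × k · v ≡ second C
      align {C} {D} {u} {v} sym-C (g , g∈ , gC≈D) uv =
        let m , m∈ , mC , mu , mv = symmetric-edge-to-start sym-C
              (to (edges back ((g ⁻¹) · u) ((g ⁻¹) · v)) (•-hasEdge (g ⁻¹) D uv))
        in m ∙ g ⁻¹ , ∙∈ m∈ (⁻¹∈ g∈) ,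
           ≈-trans (∙-• m (g ⁻¹) D) (≈-trans (•-resp m {(g ⁻¹) • D} {C} back) mC) ,
           mu , mv
        where
        back : ((g ⁻¹) • D) ≈ C
        back = ≈-trans (•-resp (g ⁻¹) {D} {g • C} (≈-sym gC≈D)) (⁻¹-•-• g C)

      -- Aligning elements `k` and `l` take `D` and `E` to `C`, their arcs going to the starting
      -- arc; so `l ∙ x` and `k` agree on an arc and are equal. Taking `x = ε` gives uniqueness of
      -- the member through an edge, and general `x` gives transitivity on the flags of one orbit.
      orbit-edge-unique : ∀ {C D E u v u′ v′ x} → SymmetricConsistent G C → D ∈ OrbitOf G C → E ∈ OrbitOf G C →
        HasEdge D u v → HasEdge E u′ v′ → x ∈ carrier G → x · u ≡ u′ → x · v ≡ v′ → (x • D) ≈ E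
      orbit-edge-unique {C} {D} {E} {x = x} sym-C D∈ E∈ uv uv′ x∈ refl refl
        with k , k∈ , kD , ku , kv ← align {C} {D} sym-C D∈ uv
           | l , l∈ , lE , lu , lv ← align {C} {E} sym-C E∈ uv′ =
        •-cancel l {x • D} {E} (≈-trans (≈-sym (∙-• l x D))
          (≈-trans (•-cong {g = l ∙ x} {h = k} D
            (rigid {g = l ∙ x} {h = k} (hasEdge⇒adj D uv) (∙∈ l∈ x∈) k∈ (trans lu (sym ku)) (trans lv (sym kv))))
          (≈-trans kD (≈-sym lE))))

      shared-edge⇒≈ : ∀ {C D E u v} → SymmetricConsistent G C → D ∈ OrbitOf G C → E ∈ OrbitOf G C →
        HasEdge D u v → HasEdge E u v → D ≈ E
      shared-edge⇒≈ {C} {D} {E} sym-C D∈ E∈ uv uv′ =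
        ≈-trans (≈-sym (ε-• D)) (orbit-edge-unique {C} {D} {E} {x = ε} sym-C D∈ E∈ uv uv′ ε∈ refl refl)

      -- Matchings of the neighbours of a vertex induced by an orbit.

      orbit-covers : ∀ C {u v} → Adj u v → ∃[ D ] D ∈ OrbitOf G C × HasEdge D u v
      orbit-covers C uv with g , g∈ , p , q ← arc-transitive (start-adj C) uv =
        g • C , (g , g∈ , ≈-refl) , inj₁ (origin C , p , q)

      -- Orients `C` so that `a`, `v`, `b` is a directed path, as `two-arcs-determine` requires.
      traverse : ∀ (C : Cycle Γ) {v a b} → HasEdge C v a → HasEdge C v b → a ≢ b →
        ∃[ D ] D ≈ C × HasArc D a v × HasArc D v b
      traverse C (inj₁ va) (inj₁ vb) a≢b = ⊥-elim (a≢b (hasArc-functional C va vb))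
      traverse C (inj₁ va) (inj₂ bv) a≢b = reverse C , reverse-≈ C , hasArc-reverse C va , hasArc-reverse C bv
      traverse C (inj₂ av) (inj₁ vb) a≢b = C , ≈-refl , av , vb
      traverse C (inj₂ av) (inj₂ bv) a≢b = ⊥-elim (a≢b (hasArc-injective C av bv))

      shared-path⇒≈ : ∀ {C D v a b} → Consistent G C → Consistent G D → a ≢ b →
        HasEdge C v a → HasEdge C v b → HasEdge D v a → HasEdge D v b → C ≈ D
      shared-path⇒≈ {C} {D} cC cD a≢b Ca Cb Da Db
        with C′ , C′≈C , Cav , Cvb ← traverse C Ca Cb a≢b
           | D′ , D′≈D , Dav , Dvb ← traverse D Da Db a≢b =
        ≈-trans (≈-sym C′≈C) (≈-trans (≈→⇒≈ {C′} {D′} (two-arcs-determine {C′} {D′}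
          (consistent-≈ {C} {C′} (≈-sym C′≈C) cC) (consistent-≈ {D} {D′} (≈-sym D′≈D) cD) Cav Cvb Dav Dvb)) D′≈D)

      -- For symmetric `C` this is a perfect matching of the neighbours of `v`, by the three lemmas
      -- that follow.
      Matched : Cycle Γ → Fin n → Fin n → Fin n → Set
      Matched C v a b = a ≢ b × ∃[ D ] D ∈ OrbitOf G C × HasEdge D v a × HasEdge D v b

      matched-total : ∀ C {v a} → Adj v a → ∃[ b ] Adj v b × Matched C v a b
      matched-total C va with D , D∈ , Dva ← orbit-covers C va
        with b , Dvb , a≢b , _ ← other-neighbour D Dva =
        b , hasEdge⇒adj D Dvb , a≢b , D , D∈ , Dva , Dvb

      matched-sym : ∀ {C v a b} → Matched C v a b → Matched C v b a
      matched-sym (a≢b , D , D∈ , va , vb) = a≢b ∘ sym , D , D∈ , vb , va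

      matched-functional : ∀ {C v a b c} → SymmetricConsistent G C → Matched C v a b → Matched C v a c → b ≡ c
      matched-functional {C} sym-C (a≢b , D , D∈ , va , vb) (a≢c , E , E∈ , va′ , vc) =
        two-edges-determine D va vb (from (edges (shared-edge⇒≈ {C} {D} {E} sym-C D∈ E∈ va va′) _ _) vc)
          (a≢b ∘ sym) (a≢c ∘ sym)

      -- Connectedness of the link for two different orbits.

      module _ (conn : Connected) (tet : Tetravalent) (all∈ : ∀ g → g ∈ carrier G) {C₁ C₂ : Cycle Γ}
               (sym₁ : SymmetricConsistent G C₁) (sym₂ : SymmetricConsistent G C₂)
               (apart : ¬ (C₂ ∈ OrbitOf G C₁)) where

        -- A pair in both matchings lies on members of both orbits; these share a path of two edges,
        -- so they coincide and the orbits meet.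
        matched-disjoint : ∀ {v a b} → Matched C₁ v a b → ¬ Matched C₂ v a b
        matched-disjoint (a≢b , D , D∈ , Da , Db) (_ , E , E∈ , Ea , Eb) =
          apart (orbits-meet {C₁} {C₂} {E} (orbit-≈ {C₁} D≈E D∈) E∈)
          where
          D≈E : D ≈ E
          D≈E = shared-path⇒≈ {D} {E} (orbit-consistent {C₁} {D} (proj₁ sym₁) D∈)
                  (orbit-consistent {C₂} {E} (proj₁ sym₂) E∈) a≢b Da Db Ea Eb

        matched-distinct : ∀ {v a p q} → Matched C₁ v a p → Matched C₂ v a q → p ≢ q
        matched-distinct ap aq refl = matched-disjoint ap aq

        -- If `r` were `a`, then `p` and `q` would both be the first partner of `a`; if `r` were
        -- `p`, then `q` would be `a`. So `a`, `p`, `q`, `r` are four different neighbours.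
        matched-avoids : ∀ {v a p q r} → Matched C₁ v a p → Matched C₂ v a q → Matched C₁ v q r → a ≢ r × p ≢ r
        matched-avoids ap aq qr =
          (λ { refl → matched-distinct ap aq (matched-functional {C₁} sym₁ ap (matched-sym {C₁} qr)) }) ,
          (λ { refl → proj₁ aq (matched-functional {C₁} sym₁ (matched-sym {C₁} ap) (matched-sym {C₁} qr)) })

        -- This is `Corner` of the map under construction, written out before the map exists.
        Link : Fin n → Fin n → Fin n → Set
        Link v a b = a ≢ b × ∃[ F ] F ∈ (OrbitOf G C₁ ∪ OrbitOf G C₂) × HasEdge F v a × HasEdge F v b

        link₁ : ∀ {v a b} → Matched C₁ v a b → Link v a b
        link₁ (a≢b , D , D∈ , e) = a≢b , D , inj₁ D∈ , e

        link₂ : ∀ {v a b} → Matched C₂ v a b → Link v a b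
        link₂ (a≢b , D , D∈ , e) = a≢b , D , inj₂ D∈ , e

        -- The alternating path `p`, `a`, `q`, `r` passes through all four neighbours.
        matchings-connect : ∀ {v a b} → Adj v a → Adj v b → Star (Link v) a b
        matchings-connect {v} {a} {b} va vb
          with p , vp , ap ← matched-total C₁ va | q , vq , aq ← matched-total C₂ va
          with r , vr , qr ← matched-total C₁ vq
          with b ≟ a | b ≟ p | b ≟ q
        ... | yes refl | _        | _        = stop
        ... | no _     | yes refl | _        = link₁ ap ◅ stop
        ... | no _     | no _     | yes refl = link₂ aq ◅ stop
        ... | no b≢a   | no b≢p   | no b≢q
          with refl ← four-neighbours tet va vp vq vr (proj₁ ap) (proj₁ aq) (proj₁ (matched-avoids ap aq qr)) (matched-distinct ap aq)
                        (proj₂ (matched-avoids ap aq qr)) (proj₁ qr) vb b≢a b≢p b≢q = link₂ aq ◅ link₁ qr ◅ stop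

        -- The map with two orbits as faces, and its flag orbits.

        twoOrbitMap : Map Γ
        twoOrbitMap = record
          { connected      = conn
          ; Face           = OrbitOf G C₁ ∪ OrbitOf G C₂
          ; face-resp      = λ {D} {E} D≈E → Sum.map (orbit-≈ {C₁} {D} {E} D≈E) (orbit-≈ {C₂} {D} {E} D≈E)
          ; two-faces      = faces
          ; link-connected = matchings-connect
          }
          where
          faces : ∀ {u v} → Adj u v → _
          faces uv with D , D∈ , Duv ← orbit-covers C₁ uv | E , E∈ , Euv ← orbit-covers C₂ uv =
            D , E , (inj₁ D∈ , Duv) , (inj₂ E∈ , Euv) ,
            (λ D≈E → apart (orbits-meet {C₁} {C₂} {E} (orbit-≈ {C₁} D≈E D∈) E∈)) ,
            λ { {F} (inj₁ F∈) Fuv → inj₁ (shared-edge⇒≈ {C₁} {F} {D} sym₁ F∈ D∈ Fuv Duv)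
              ; {F} (inj₂ F∈) Fuv → inj₂ (shared-edge⇒≈ {C₂} {F} {E} sym₂ F∈ E∈ Fuv Euv) }

        open Flag

        all∈AutMap : ∀ g → g ∈ carrier (AutMap twoOrbitMap)
        all∈AutMap g F = mk⇔
          (Sum.map (orbit-• {C₁} {F} {g} (all∈ g)) (orbit-• {C₂} {F} {g} (all∈ g)))
          (Sum.map (orbit-unmove {C₁} {F} {g} (all∈ g)) (orbit-unmove {C₂} {F} {g} (all∈ g)))

        -- The element matching the arcs of the two flags also matches their faces, since only one
        -- member of the orbit passes through an edge.
        same-cycle-orbit⇒SameOrbit : ∀ {C} → SymmetricConsistent G C → (Φ Ψ : Flag twoOrbitMap) →
          face Φ ∈ OrbitOf G C → face Ψ ∈ OrbitOf G C → SameOrbit Φ Ψ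
        same-cycle-orbit⇒SameOrbit {C} sym-C Φ Ψ Φ∈ Ψ∈
          with g , g∈ , gu , gv ← arc-transitive (hasEdge⇒adj (face Φ) (onFace Φ)) (hasEdge⇒adj (face Ψ) (onFace Ψ)) =
          g , all∈AutMap g , gu , inj₁ (gu , gv) ,
          orbit-edge-unique {C} {face Φ} {face Ψ} {x = g} sym-C Φ∈ Ψ∈ (onFace Φ) (onFace Ψ) g∈ gu gv

        -- Serves the 0-adjacent and 1-adjacent flags, which keep the face.
        ≈-face⇒SameOrbit : ∀ (Φ Ψ : Flag twoOrbitMap) → face Φ ≈ face Ψ → SameOrbit Φ Ψ
        ≈-face⇒SameOrbit Φ Ψ F≈ with isFace Φ
        ... | inj₁ Φ∈ = same-cycle-orbit⇒SameOrbit {C₁} sym₁ Φ Ψ Φ∈ (orbit-≈ {C₁} F≈ Φ∈)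
        ... | inj₂ Φ∈ = same-cycle-orbit⇒SameOrbit {C₂} sym₂ Φ Ψ Φ∈ (orbit-≈ {C₂} F≈ Φ∈)

        -- Flags in one orbit have faces in the same orbit of cycles; sharing an edge, these faces
        -- would be equal.
        2-adjacent⇒¬SameOrbit : ∀ (Φ Ψ : Flag twoOrbitMap) → DiffersExactlyIn 2F Φ Ψ → ¬ SameOrbit Φ Ψ
        2-adjacent⇒¬SameOrbit Φ Ψ (_ , edge , F≉) (g , _ , _ , _ , gF≈) = F≉ (same-face (isFace Φ))
          where
          shared : HasEdge (face Ψ) (vertex Φ) (end Φ)
          shared = [ (λ (v≡ , e≡) → subst₂ (HasEdge (face Ψ)) (sym v≡) (sym e≡) (onFace Ψ))
                   , (λ (v≡ , e≡) → subst₂ (HasEdge (face Ψ)) (sym v≡) (sym e≡) (swap (onFace Ψ))) ]′ edge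
          same-face : face Φ ∈ (OrbitOf G C₁ ∪ OrbitOf G C₂) → face Φ ≈ face Ψ
          same-face (inj₁ Φ∈) = shared-edge⇒≈ {C₁} {face Φ} {face Ψ} sym₁ Φ∈
            (orbit-≈ {C₁} gF≈ (orbit-• {C₁} {face Φ} {g} (all∈ g) Φ∈)) (onFace Φ) shared
          same-face (inj₂ Φ∈) = shared-edge⇒≈ {C₂} {face Φ} {face Ψ} sym₂ Φ∈
            (orbit-≈ {C₂} gF≈ (orbit-• {C₂} {face Φ} {g} (all∈ g) Φ∈)) (onFace Φ) shared

        startFlag : (C : Cycle Γ) → C ∈ (OrbitOf G C₁ ∪ OrbitOf G C₂) → Flag twoOrbitMap
        startFlag C C∈ = record
          { vertex = start C ; end = second C ; face = C ; isFace = C∈ ; onFace = inj₁ (start-arc C) }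

        twoOrbitMap-class2 : Class2₀₁ twoOrbitMap
        twoOrbitMap-class2 = record
          -- An automorphism joining the two flags would carry `C₁` to `C₂`, against `apart`.
          { two-orbits = Φ₁ , Φ₂ , (λ (g , _ , _ , _ , gC₁≈C₂) → apart (g , all∈ g , gC₁≈C₂)) , λ Χ → orbit Χ (isFace Χ)
          ; 0-same     = λ Φ → ≈-face⇒SameOrbit Φ (Φ ^ 0F) ≈-refl
          ; 1-same     = λ Φ → ≈-face⇒SameOrbit Φ (Φ ^ 1F) ≈-refl
          ; 2-differs  = λ Φ → 2-adjacent⇒¬SameOrbit Φ (Φ ^ 2F) (proj₁ (proj₂ (adjacent-flag 2F Φ)))
          }
          where
          Φ₁ = startFlag C₁ (inj₁ (orbit-refl C₁))
          Φ₂ = startFlag C₂ (inj₂ (orbit-refl C₂))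
          orbit : ∀ Χ → face Χ ∈ (OrbitOf G C₁ ∪ OrbitOf G C₂) → SameOrbit Φ₁ Χ ⊎ SameOrbit Φ₂ Χ
          orbit Χ (inj₁ Χ∈) = inj₁ (same-cycle-orbit⇒SameOrbit {C₁} sym₁ Φ₁ Χ (orbit-refl C₁) Χ∈)
          orbit Χ (inj₂ Χ∈) = inj₂ (same-cycle-orbit⇒SameOrbit {C₂} sym₂ Φ₂ Χ (orbit-refl C₂) Χ∈)

theorem2p7 : ∀ {n : ℕ} (Γ : Graph n) → Graph.Connected Γ → Graph.Tetravalent Γ →
    (G : Subgroup (Aut Γ)) → ArcRegular G →
    ((M : Map Γ) → Class2₀₁ M → carrier (AutMap M) ≐ carrier G → AllOrbitsSymmetric G)
    ×
    (carrier G ≐ U → AllOrbitsSymmetric G →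
    (C₁ C₂ : Cycle Γ) → Consistent G C₁ → Consistent G C₂ → ¬ (C₂ ∈ OrbitOf G C₁) →
    Σ (Map Γ) λ M → Class2₀₁ M × carrier (AutMap M) ≐ carrier G × Map.Face M ≐ OrbitOf G C₁ ∪ OrbitOf G C₂)
theorem2p7 Γ conn tet G reg =
  class2⇒symmetric G reg tet ,
  λ (_ , U⊆G) allSym C₁ C₂ cons₁ cons₂ apart →
    let all∈ : ∀ g → g ∈ carrier G
        all∈ g = U⊆G {g} _
        -- Each orbit is evaluated at its own representative.
        sym₁ = allSym C₁ cons₁ {C₁} (orbit-refl G C₁)
        sym₂ = allSym C₂ cons₂ {C₂} (orbit-refl G C₂)
    in twoOrbitMap G reg conn tet all∈ {C₁} {C₂} sym₁ sym₂ apart ,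
       twoOrbitMap-class2 G reg conn tet all∈ {C₁} {C₂} sym₁ sym₂ apart ,
       ((λ {g} _ → all∈ g) , λ {g} _ → all∈AutMap G reg conn tet all∈ {C₁} {C₂} sym₁ sym₂ apart g) ,
       (id , id)
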